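{- Let $G$ be a graph on the vertex set $\{1,\dots,n\}$ whose adjacency matrix $\Gamma$ is nonsingular over $\mathbb{F}_2$. Then $\Gamma^{ -1}$ (the inverse over $\mathbb{F}_2$) is the adjacency matrix of a graph that is edge-locally equivalent to $G$; that is, $\Gamma^{ -1}$ can be obtained from $\Gamma$ by performing a sequence of edge-local complementations on the corresponding graph.
   Context: Graphs are finite, undirected and simple with vertex set $V=\{1,\dots,n\}$; an adjacency matrix is a symmetric matrix over $\mathbb{F}_2$ with zero diagonal. Local complementation: for a vertex $i$, $G*i$ is the graph on $V$ obtained from $G$ by replacing the subgraph induced on the neighborhood $N(i)$ by its complement and leaving the rest unchanged. For an edge $e=\{i,j\}$ of $G$, the edge-local complement is $G*e=((G*i)*j)*i=((G*j)*i)*j$. Two graphs $G,G'$ on $V$ are edge-locally equivalent if there is a finite (possibly empty) sequence $e_1,\dots,e_N$ of 2-element subsets of $V$ such that $e_1$ is an edge of $G$, $e_\alpha$ is an edge of $((G*e_1)*\dots)*e_{\alpha-1}$ for $\alpha=2,\dots,N$, and $((G*e_1)*\dots)*e_N=G'$. -}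

module Defs where

open import Algebra.Bundles using (CommutativeRing)
open import Algebra.Properties.Monoid.Sum using () renaming (sum to monoidSum)
open import Data.Bool.Base using (Bool; true; false; not; _∧_; if_then_else_)
open import Data.Bool.Properties using (xor-∧-commutativeRing; ∧-comm)
open import Data.Fin.Base using (Fin)
open import Data.Fin.Properties using (_≟_)
open import Data.List.Base using (List; []; _∷_; foldl)
open import Data.Nat.Base using (ℕ)
open import Data.Product.Base using (∃-syntax; _×_; _,_)
open import Data.Unit.Base using (⊤)
open import Data.Vec.Functional using (Vector)
open import Relation.Binary.PropositionalEquality using (_≡_; refl; sym; cong; cong₂)
open import Relation.Nullary.Decidable using (does; yes; no)
open import Relation.Nullary.Negation using (contradiction)

-- The field with two elements: Bool with 0 = false, 1 = true, + = xor, * = ∧.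

module 𝔽₂ = CommutativeRing xor-∧-commutativeRing

𝔽₂ : Set
𝔽₂ = 𝔽₂.Carrier

∑ : ∀ {n} → Vector 𝔽₂ n → 𝔽₂
∑ = monoidSum 𝔽₂.+-monoid

Matrix : ℕ → Set
Matrix n = Fin n → Fin n → 𝔽₂

-- Matrices are functions, so they are compared entrywise.

infix 4 _≈_

_≈_ : ∀ {n} → Matrix n → Matrix n → Set
A ≈ B = ∀ a b → A a b ≡ B a b

I : ∀ {n} → Matrix n
I a b = if does (a ≟ b) then 𝔽₂.1# else 𝔽₂.0#

infixl 7 _·_

_·_ : ∀ {n} → Matrix n → Matrix n → Matrix n
(A · B) a b = ∑ λ k → A a k 𝔽₂.* B k b

record Nonsingular {n} (A : Matrix n) : Set where
  field
    inverse  : Matrix n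
    inverseˡ : inverse · A ≈ I
    inverseʳ : A · inverse ≈ I

infix 8 _⁻¹

_⁻¹ : ∀ {n} (A : Matrix n) {{_ : Nonsingular A}} → Matrix n
(A ⁻¹) {{ns}} = Nonsingular.inverse ns

-- A simple graph on Fin n, given by its adjacency matrix.

record Graph (n : ℕ) : Set where
  field
    adj        : Matrix n
    adj-sym    : ∀ a b → adj a b ≡ adj b a
    adj-irrefl : ∀ a → adj a a ≡ 𝔽₂.0#

open Graph public

Edge : ∀ {n} → Graph n → Fin n → Fin n → Set
Edge G i j = adj G i j ≡ 𝔽₂.1#

infixl 6 _*_ _*ᵉ_

-- Only pairs of distinct vertices of N(i) are complemented; this keeps
-- the graph loopless.

_*_ : ∀ {n} → Graph n → Fin n → Graph n
_*_ {n} G i = record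
  { adj        = adj*
  ; adj-sym    = adj*-sym
  ; adj-irrefl = adj*-irrefl
  }
  where
  flipped : Fin n → Fin n → Bool
  flipped a b = not (does (a ≟ b)) ∧ (adj G i a ∧ adj G i b)

  adj* : Matrix n
  adj* a b = if flipped a b then not (adj G a b) else adj G a b

  ≟-sym : ∀ (a b : Fin n) → does (a ≟ b) ≡ does (b ≟ a)
  ≟-sym a b with a ≟ b | b ≟ a
  ... | yes _   | yes _   = refl
  ... | no  _   | no  _   = refl
  ... | yes a≡b | no  b≢a = contradiction (sym a≡b) b≢a
  ... | no  a≢b | yes b≡a = contradiction (sym b≡a) a≢b

  flipped-sym : ∀ a b → flipped a b ≡ flipped b a
  flipped-sym a b =
    cong₂ _∧_ (cong not (≟-sym a b)) (∧-comm (adj G i a) (adj G i b))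

  adj*-sym : ∀ a b → adj* a b ≡ adj* b a
  adj*-sym a b = cong₂ (λ f x → if f then not x else x)
                       (flipped-sym a b) (adj-sym G a b)

  adj*-irrefl : ∀ a → adj* a a ≡ 𝔽₂.0#
  adj*-irrefl a with a ≟ a
  ... | yes _   = adj-irrefl G a
  ... | no  a≢a = contradiction refl a≢a

-- An edge {i , j} is presented by either of the pairs (i , j), (j , i); when
-- {i , j} is an edge of G both give the same graph, that is,
-- G * i * j * i and G * j * i * j have the same adjacency matrix.

_*ᵉ_ : ∀ {n} → Graph n → Fin n × Fin n → Graph n
G *ᵉ (i , j) = G * i * j * i

-- Each pair is an edge of the graph obtained from G by the preceding pairs.

SuccessiveEdges : ∀ {n} → Graph n → List (Fin n × Fin n) → Set
SuccessiveEdges G []             = ⊤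
SuccessiveEdges G ((i , j) ∷ es) = Edge G i j × SuccessiveEdges (G *ᵉ (i , j)) es

EdgeLocallyEquivalent : ∀ {n} → Graph n → Graph n → Set
EdgeLocallyEquivalent G G′ =
  ∃[ es ] SuccessiveEdges G es × adj (foldl _*ᵉ_ G es) ≈ adj G′

{-# OPTIONS --safe #-}
-- Exchanging the coordinates in S between the argument w and the value A w of
-- a symmetric matrix A gives the principal pivot transform of A on S.  An
-- edge-local complementation at {i , j} is the transform on S = {i , j}, and
-- successive transforms compose to the transform on the symmetric difference.
-- If A is nonsingular, the transform on S has an edge at every vertex i outside
-- S whose other end is outside S too: otherwise coordinate i of A x would
-- depend on the coordinates of A x in S only.  So S can be enlarged by edges
-- until it contains all vertices, and the transform on the full set is the
-- inverse.
module Submission where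

open import Defs
open import Algebra.Properties.Semiring.Sum 𝔽₂.semiring
  using (sum-cong-≗; sum-replicate-zero; ∑-distrib-+; *-distribˡ-sum)
open import Data.Bool.Base using (Bool; true; false; not; _∧_; _xor_; if_then_else_)
open import Data.Bool.Properties
  using (∧-comm; ∧-zeroʳ; ∧-distribˡ-xor; xor-comm; xor-identityʳ)
  renaming (_≟_ to _≟ᵇ_)
open import Data.Bool.Solver using (module xor-∧-Solver)
open import Data.Fin.Base using (Fin; zero; suc)
open import Data.Fin.Properties using (_≟_; any?)
open import Data.List.Base using (List; []; _∷_; foldl; allFin)
open import Data.List.Membership.Propositional using (_∈_)
open import Data.List.Membership.Propositional.Properties using (∈-allFin)
open import Data.List.Relation.Unary.Any using (here; there)
open import Data.Nat.Base using (ℕ; suc)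
open import Data.Product.Base using (∃-syntax; _×_; _,_)
open import Data.Sum.Base using (_⊎_; inj₁; inj₂)
open import Data.Unit.Base using (tt)
open import Data.Vec.Functional using (Vector)
open import Relation.Binary.PropositionalEquality
open import Relation.Nullary.Decidable using (yes; no; dec-true; dec-false; _×-dec_)
open import Relation.Nullary.Negation using (contradiction)

open ≡-Reasoning
open xor-∧-Solver using (solve; _:=_; _:+_; _:*_; con)

private
  variable
    n : ℕ

-- Unit vectors and matrix-vector products.

infixr 7 _∙_

_∙_ : Matrix n → Vector 𝔽₂ n → Vector 𝔽₂ n
(A ∙ v) a = ∑ λ b → A a b ∧ v b

I-refl : ∀ (a : Fin n) → I a a ≡ true
I-refl a rewrite dec-true (a ≟ a) refl = refl

I-≢ : ∀ {a b : Fin n} → a ≢ b → I a b ≡ false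
I-≢ {a = a} {b} a≢b rewrite dec-false (a ≟ b) a≢b = refl

I-sym : ∀ (a b : Fin n) → I a b ≡ I b a
I-sym a b with a ≟ b
... | yes refl = sym (I-refl a)
... | no a≢b   = sym (I-≢ (λ b≡a → a≢b (sym b≡a)))

∑-zero : ∀ (f : Vector 𝔽₂ n) → (∀ k → f k ≡ false) → ∑ f ≡ false
∑-zero {n} f f≗0 = trans (sum-cong-≗ f≗0) (sum-replicate-zero n)

∑-I : ∀ (a : Fin n) (v : Vector 𝔽₂ n) → ∑ (λ b → I a b ∧ v b) ≡ v a
∑-I {suc n} zero v =
  trans (cong (v zero xor_) (∑-zero {n} _ λ _ → refl)) (xor-identityʳ (v zero))
∑-I (suc a) v = trans (sum-cong-≗ λ b → cong (_∧ v (suc b)) (I-suc b)) (∑-I a (λ b → v (suc b)))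
  where
  I-suc : ∀ b → I (suc a) (suc b) ≡ I a b
  I-suc b with a ≟ b
  ... | yes _ = refl
  ... | no  _ = refl

I-∧ : ∀ (a b : Fin n) (f : Fin n → 𝔽₂) → I a b ∧ f b ≡ I a b ∧ f a
I-∧ a b f with a ≟ b
... | yes refl = refl
... | no  _    = refl

∙-cong : ∀ (A : Matrix n) {u v : Vector 𝔽₂ n} → u ≗ v → A ∙ u ≗ A ∙ v
∙-cong A u≗v a = sum-cong-≗ λ b → cong (A a b ∧_) (u≗v b)

∙-distrib-xor : ∀ (A : Matrix n) (u v : Vector 𝔽₂ n) a →
  (A ∙ λ b → u b xor v b) a ≡ (A ∙ u) a xor (A ∙ v) a
∙-distrib-xor {n} A u v a =
  trans (sum-cong-≗ λ b → ∧-distribˡ-xor (A a b) (u b) (v b)) (∑-distrib-+ {n} _ _)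

∙-scaled-I : ∀ (A : Matrix n) i c a → (A ∙ λ b → I i b ∧ c) a ≡ A a i ∧ c
∙-scaled-I A i c a = trans
  (sum-cong-≗ λ b → solve 3 (λ x y z → x :* (y :* z) := y :* (x :* z)) refl (A a b) (I i b) c)
  (∑-I i (λ b → A a b ∧ c))

∙-column : ∀ (A : Matrix n) a b → (A ∙ λ k → I k b) a ≡ A a b
∙-column A a b = trans
  (sum-cong-≗ λ k → trans (∧-comm (A a k) (I k b)) (cong (_∧ A a k) (I-sym k b)))
  (∑-I b (A a))

-- Local complementation as a matrix update.

-- The rank-one matrix built from row `i` is added; the term `I a b` cancels its diagonal, since
-- `A i a ∧ A i a` is `A i a`.
IsComplement : Fin n → Matrix n → Matrix n → Set
IsComplement i A B = ∀ a b → B a b ≡ A a b xor (A i a ∧ (A i b xor I a b))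

*-isComplement : ∀ (G : Graph n) i → IsComplement i (adj G) (adj (G * i))
*-isComplement G i a b with a ≟ b
... | yes refl = flip-diag (adj G a a) (adj G i a)
  where
  flip-diag : ∀ x g → x ≡ x xor (g ∧ (g xor true))
  flip-diag x     false = sym (xor-identityʳ x)
  flip-diag x     true  = sym (xor-identityʳ x)
... | no _ = flip (adj G a b) (adj G i a) (adj G i b)
  where
  flip : ∀ x g h → (if g ∧ h then not x else x) ≡ x xor (g ∧ (h xor false))
  flip x     false h     = sym (xor-identityʳ x)
  flip x     true  false = sym (xor-identityʳ x)
  flip false true  true  = refl
  flip true  true  true  = refl

-- The update meets `v` only through the scalar `(A ∙ v) i` and the entry `v a`, so iterated
-- complements can be followed by a few scalars.
complement-∙ : ∀ i (A B : Matrix n) → IsComplement i A B → ∀ v a →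
  (B ∙ v) a ≡ (A ∙ v) a xor (A i a ∧ ((A ∙ v) i xor v a))
complement-∙ {n} i A B AB v a = begin
  ∑ (λ b → B a b ∧ v b)
    ≡⟨ sum-cong-≗ (λ b → trans (cong (_∧ v b) (AB a b))
         (solve 5 (λ x g h d y → (x :+ (g :* (h :+ d))) :* y
                              := (x :* y) :+ (g :* ((h :* y) :+ (d :* y)))) refl
           (A a b) (A i a) (A i b) (I a b) (v b))) ⟩
  ∑ (λ b → (A a b ∧ v b) xor (A i a ∧ ((A i b ∧ v b) xor (I a b ∧ v b))))
    ≡⟨ ∑-distrib-+ {n} _ _ ⟩
  (A ∙ v) a xor ∑ (λ b → A i a ∧ ((A i b ∧ v b) xor (I a b ∧ v b)))
    ≡⟨ cong ((A ∙ v) a xor_) (*-distribˡ-sum {n} (A i a) _) ⟨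
  (A ∙ v) a xor (A i a ∧ ∑ (λ b → (A i b ∧ v b) xor (I a b ∧ v b)))
    ≡⟨ cong (λ s → (A ∙ v) a xor (A i a ∧ s))
         (trans (∑-distrib-+ {n} _ _) (cong ((A ∙ v) i xor_) (∑-I a v))) ⟩
  (A ∙ v) a xor (A i a ∧ ((A ∙ v) i xor v a)) ∎

-- Coordinate exchange and edge-local complementation.

exchange : (Fin n → Bool) → Vector 𝔽₂ n → Vector 𝔽₂ n → Vector 𝔽₂ n
exchange S x w k = if S k then w k else x k

exchange-exchange : ∀ (S T : Fin n → Bool) x w →
  exchange T (exchange S x w) (exchange S w x) ≗ exchange (λ k → T k xor S k) x w
exchange-exchange S T x w k with T k | S k
... | true  | true  = refl
... | true  | false = refl
... | false | true  = refl
... | false | false = refl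

-- The indicator of the edge when `i` and `j` differ; `xor` fits the symmetric differences that
-- arise on composing exchanges.
pair : Fin n → Fin n → Fin n → Bool
pair i j k = I i k xor I j k

-- The exchange adds multiples of two unit vectors to `x`, a form to which linearity applies.
exchange-pair : ∀ {i j : Fin n} → i ≢ j → ∀ x w k →
  exchange (pair i j) x w k ≡ x k xor (I i k ∧ (w i xor x i)) xor (I j k ∧ (w j xor x j))
exchange-pair {i = i} {j} i≢j x w k with i ≟ k | j ≟ k
... | yes refl | yes refl = contradiction refl i≢j
... | yes refl | no _     = solve 2 (λ x w → w := x :+ ((w :+ x) :+ con false)) refl (x k) (w k)
... | no _     | yes refl = solve 2 (λ x w → w := x :+ (w :+ x)) refl (x k) (w k)
... | no _     | no _     = sym (xor-identityʳ (x k))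

edge-≢ : ∀ (G : Graph n) {i j} → Edge G i j → i ≢ j
edge-≢ G {i} ij refl with () ← trans (sym ij) (adj-irrefl G i)

-- Values at a of the three complements of G at i, j and i, applied to the
-- vector v that has y = adj G ∙ u on {i , j} and u elsewhere: g and h are the
-- entries at a of rows i and j of G, q = u j + y j, and di, dj are the entries
-- of I.

first-complement : ∀ y g h yi ui q v →
  (y xor (g ∧ (yi xor ui)) xor (h ∧ q)) xor (g ∧ ((yi xor q) xor v))
  ≡ y xor (h ∧ q) xor (g ∧ (ui xor q xor v))
first-complement = solve 7 (λ y g h yi ui q v →
  (y :+ ((g :* (yi :+ ui)) :+ (h :* q))) :+ (g :* ((yi :+ q) :+ v))
  := y :+ ((h :* q) :+ (g :* (ui :+ (q :+ v))))) refl

second-complement : ∀ y g h ui q v dj →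
  (y xor (h ∧ q) xor (g ∧ (ui xor q xor v))) xor ((h xor g xor dj) ∧ ((ui xor q) xor v))
  ≡ y xor (h ∧ (ui xor v)) xor (dj ∧ (ui xor q xor v))
second-complement = solve 7 (λ y g h ui q v dj →
  (y :+ ((h :* q) :+ (g :* (ui :+ (q :+ v))))) :+ ((h :+ (g :+ dj)) :* ((ui :+ q) :+ v))
  := y :+ ((h :* (ui :+ v)) :+ (dj :* (ui :+ (q :+ v))))) refl

third-complement : ∀ y h ui q v dj di →
  (y xor (h ∧ (ui xor v)) xor (dj ∧ (ui xor q xor v))) xor ((h xor dj xor di) ∧ (ui xor v))
  ≡ y xor (di ∧ (ui xor v)) xor (dj ∧ q)
third-complement = solve 7 (λ y h ui q v dj di →
  (y :+ ((h :* (ui :+ v)) :+ (dj :* (ui :+ (q :+ v))))) :+ ((h :+ (dj :+ di)) :* (ui :+ v))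
  := y :+ ((di :* (ui :+ v)) :+ (dj :* q))) refl

row-sum : ∀ g h dj di → (g xor false) xor ((h xor g xor dj) xor di) ≡ h xor dj xor di
row-sum = solve 4 (λ g h dj di →
  (g :+ con false) :+ ((h :+ (g :+ dj)) :+ di) := h :+ (dj :+ di)) refl

xor-conjugate : ∀ x y z → x xor y xor z xor x ≡ y xor z
xor-conjugate = solve 3 (λ x y z → x :+ (y :+ (z :+ x)) := y :+ z) refl

xor-cancel : ∀ x y → x xor (y xor x) xor false ≡ y
xor-cancel = solve 2 (λ x y → x :+ ((y :+ x) :+ con false) := y) refl

-- By `complement-∙`, each complement needs only the previous matrix's row and its product with `v`
-- at the complemented vertex; the local lemmas supply these. The right-hand side is
-- `exchange (pair i j) y u` as expanded by `exchange-pair`.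
pivot-∙ : ∀ (G : Graph n) {A₁ A₂ A₃ : Matrix n} {i j} → Edge G i j →
  IsComplement i (adj G) A₁ → IsComplement j A₁ A₂ → IsComplement i A₂ A₃ →
  ∀ (u y v : Vector 𝔽₂ n) → v i ≡ y i → v j ≡ y j →
  (∀ a → (adj G ∙ v) a ≡
    y a xor (adj G i a ∧ (y i xor u i)) xor (adj G j a ∧ (u j xor y j))) →
  ∀ a → (A₃ ∙ v) a ≡ y a xor (I i a ∧ (u i xor y i)) xor (I j a ∧ (u j xor y j))
pivot-∙ G {A₁} {A₂} {A₃} {i} {j} ij c₁ c₂ c₃ u y v v-i v-j G∙v a = begin
  (A₃ ∙ v) a
    ≡⟨ complement-∙ i A₂ A₃ c₃ v a ⟩
  (A₂ ∙ v) a xor (A₂ i a ∧ ((A₂ ∙ v) i xor v a))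
    ≡⟨ cong₂ _xor_ (A₂∙v a) (cong₂ _∧_ (A₂-row-i a) (cong (_xor v a) A₂∙v-i)) ⟩
  (y a xor (h a ∧ (u i xor v a)) xor (I j a ∧ (u i xor q xor v a)))
    xor ((h a xor I j a xor I i a) ∧ (u i xor v a))
    ≡⟨ third-complement (y a) (h a) (u i) q (v a) (I j a) (I i a) ⟩
  y a xor (I i a ∧ (u i xor v a)) xor (I j a ∧ q)
    -- The factor `I i a` vanishes unless `a` is `i`, so `v a` may be replaced by `v i`.
    ≡⟨ cong (λ t → y a xor t xor (I j a ∧ q))
         (trans (I-∧ i a (λ k → u i xor v k)) (cong (λ t → I i a ∧ (u i xor t)) v-i)) ⟩
  y a xor (I i a ∧ (u i xor y i)) xor (I j a ∧ q) ∎
  where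
  g = adj G i
  h = adj G j
  q = u j xor y j

  ji : h i ≡ true
  ji = trans (adj-sym G j i) ij

  Iji : I j i ≡ false
  Iji = I-≢ λ j≡i → edge-≢ G ij (sym j≡i)

  G∙v-i : (adj G ∙ v) i ≡ y i xor q
  G∙v-i rewrite G∙v i | adj-irrefl G i | ji = refl

  A₁∙v : ∀ a → (A₁ ∙ v) a ≡ y a xor (h a ∧ q) xor (g a ∧ (u i xor q xor v a))
  A₁∙v a = begin
    (A₁ ∙ v) a
      ≡⟨ complement-∙ i (adj G) A₁ c₁ v a ⟩
    (adj G ∙ v) a xor (g a ∧ ((adj G ∙ v) i xor v a))
      ≡⟨ cong₂ _xor_ (G∙v a) (cong (λ t → g a ∧ (t xor v a)) G∙v-i) ⟩
    (y a xor (g a ∧ (y i xor u i)) xor (h a ∧ q)) xor (g a ∧ ((y i xor q) xor v a))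
      ≡⟨ first-complement (y a) (g a) (h a) (y i) (u i) q (v a) ⟩
    y a xor (h a ∧ q) xor (g a ∧ (u i xor q xor v a)) ∎

  A₁∙v-j : (A₁ ∙ v) j ≡ u i xor q
  A₁∙v-j = trans (A₁∙v j) simplify
    where
    simplify : y j xor (h j ∧ q) xor (g j ∧ (u i xor q xor v j)) ≡ u i xor q
    simplify rewrite adj-irrefl G j | ij | v-j = xor-conjugate (y j) (u i) q

  A₁-row-j : ∀ a → A₁ j a ≡ h a xor g a xor I j a
  A₁-row-j a rewrite c₁ j a | ij = refl

  A₂∙v : ∀ a → (A₂ ∙ v) a ≡
    y a xor (h a ∧ (u i xor v a)) xor (I j a ∧ (u i xor q xor v a))
  A₂∙v a = begin
    (A₂ ∙ v) a
      ≡⟨ complement-∙ j A₁ A₂ c₂ v a ⟩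
    (A₁ ∙ v) a xor (A₁ j a ∧ ((A₁ ∙ v) j xor v a))
      ≡⟨ cong₂ _xor_ (A₁∙v a) (cong₂ _∧_ (A₁-row-j a) (cong (_xor v a) A₁∙v-j)) ⟩
    (y a xor (h a ∧ q) xor (g a ∧ (u i xor q xor v a)))
      xor ((h a xor g a xor I j a) ∧ ((u i xor q) xor v a))
      ≡⟨ second-complement (y a) (g a) (h a) (u i) q (v a) (I j a) ⟩
    y a xor (h a ∧ (u i xor v a)) xor (I j a ∧ (u i xor q xor v a)) ∎

  A₂∙v-i : (A₂ ∙ v) i ≡ u i
  A₂∙v-i = trans (A₂∙v i) simplify
    where
    simplify : y i xor (h i ∧ (u i xor v i)) xor (I j i ∧ (u i xor q xor v i)) ≡ u i
    simplify rewrite ji | Iji | v-i = xor-cancel (y i) (u i)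

  A₂-row-i : ∀ a → A₂ i a ≡ h a xor I j a xor I i a
  A₂-row-i a
    -- Row `i` is unchanged by the first complement, and `A₁ j i` is 1, so the second one adds row
    -- `j` of `A₁` and a diagonal correction to row `i`.
    rewrite c₂ i a | A₁-row-j i | A₁-row-j a | c₁ i a
          | ji | adj-irrefl G i | Iji =
    row-sum (g a) (h a) (I j a) (I i a)

-- The exchanged argument differs from `u` at most at `i` and `j`, so its image under `adj G`
-- differs from `adj G ∙ u` by multiples of two columns, which are rows by symmetry. This is the
-- input of `pivot-∙`.
*ᵉ-exchange : ∀ (G : Graph n) i j → Edge G i j → ∀ u →
  adj (G *ᵉ (i , j)) ∙ exchange (pair i j) u (adj G ∙ u) ≗ exchange (pair i j) (adj G ∙ u) u
*ᵉ-exchange G i j ij u a = trans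
  (pivot-∙ G ij (*-isComplement G i) (*-isComplement (G * i) j) (*-isComplement (G * i * j) i)
    u y v v-i v-j G∙v a)
  (sym (exchange-pair i≢j y u a))
  where
  g = adj G i
  h = adj G j
  y = adj G ∙ u
  v = exchange (pair i j) u y
  p = y i xor u i
  q = u j xor y j

  i≢j : i ≢ j
  i≢j = edge-≢ G ij

  Iij : I i j ≡ false
  Iij = I-≢ i≢j

  Iji : I j i ≡ false
  Iji = I-≢ λ j≡i → i≢j (sym j≡i)

  v-i : v i ≡ y i
  v-i rewrite I-refl i | Iji = refl

  v-j : v j ≡ y j
  v-j rewrite I-refl j | Iij = refl

  G∙v : ∀ a → (adj G ∙ v) a ≡ y a xor (g a ∧ p) xor (h a ∧ q)
  G∙v a = begin
    (adj G ∙ v) a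
      ≡⟨ ∙-cong (adj G) (exchange-pair i≢j u y) a ⟩
    (adj G ∙ λ k → u k xor (I i k ∧ p) xor (I j k ∧ (y j xor u j))) a
      ≡⟨ ∙-distrib-xor (adj G) u _ a ⟩
    y a xor (adj G ∙ λ k → (I i k ∧ p) xor (I j k ∧ (y j xor u j))) a
      ≡⟨ cong (y a xor_) (∙-distrib-xor (adj G) _ _ a) ⟩
    y a xor (adj G ∙ λ k → I i k ∧ p) a xor (adj G ∙ λ k → I j k ∧ (y j xor u j)) a
      ≡⟨ cong (y a xor_) (cong₂ _xor_ (scaled-column i p) (scaled-column j (y j xor u j))) ⟩
    y a xor (g a ∧ p) xor (h a ∧ (y j xor u j))
      ≡⟨ cong (λ t → y a xor (g a ∧ p) xor (h a ∧ t)) (xor-comm (y j) (u j)) ⟩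
    y a xor (g a ∧ p) xor (h a ∧ q) ∎
    where
    scaled-column : ∀ k c → (adj G ∙ λ b → I k b ∧ c) a ≡ adj G k a ∧ c
    scaled-column k c =
      trans (∙-scaled-I (adj G) k c a) (cong (_∧ c) (adj-sym G a k))

-- Principal pivot transforms and the enlargement of `S`.

-- Column b of C and of I are the argument and the value of A = C⁻¹ whose
-- coordinates in S are exchanged.
IsTransform : Matrix n → (Fin n → Bool) → Matrix n → Set
IsTransform C S B = ∀ b →
  B ∙ exchange S (λ k → C k b) (λ k → I k b) ≗ exchange S (λ k → I k b) (λ k → C k b)

-- Column `i` of `C` is the test vector. Its exchanged argument is zero on `S`, where the unit
-- vector at `i` vanishes, yet its image has entry 1 at `i`; so row `i` is nonzero somewhere outside
-- `S`.
transform-edge : ∀ (C : Matrix n) S (G : Graph n) → IsTransform C S (adj G) →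
  ∀ i → S i ≡ false → ∃[ j ] Edge G i j × S j ≡ false
transform-edge {n} C S G tr i i∉S
  with any? (λ j → (adj G i j ≟ᵇ true) ×-dec (S j ≟ᵇ false))
... | yes found = found
... | no  none  = contradiction (trans (sym zero-at-i) one-at-i) λ ()
  where
  c e : Vector 𝔽₂ n
  c k = C k i
  e k = I k i

  one-at-i : (adj G ∙ exchange S c e) i ≡ true
  one-at-i = trans (tr i i) (trans (cong (if_then c i else e i) i∉S) (I-refl i))

  term-zero : ∀ k → adj G i k ∧ exchange S c e k ≡ false
  term-zero k with S k in Sk≡
  ... | true  = trans (cong (adj G i k ∧_) (I-≢ k≢i)) (∧-zeroʳ (adj G i k))
    where
    k≢i : k ≢ i
    k≢i refl = contradiction (trans (sym Sk≡) i∉S) λ ()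
  ... | false with adj G i k in ik
  ...   | true  = contradiction (k , ik , Sk≡) none
  ...   | false = refl

  zero-at-i : (adj G ∙ exchange S c e) i ≡ false
  zero-at-i = ∑-zero _ term-zero

-- The hypothesis identifies `exchange S e c` with `adj G ∙ u`, so the pivot at the edge acts as a
-- second exchange.
transform-*ᵉ : ∀ (C : Matrix n) S (G : Graph n) {i j} → IsTransform C S (adj G) → Edge G i j →
  IsTransform C (λ k → pair i j k xor S k) (adj (G *ᵉ (i , j)))
transform-*ᵉ C S G {i} {j} tr ij b a = begin
  (B′ ∙ exchange T c e) a
    ≡⟨ ∙-cong B′ (exchange-exchange S P c e) a ⟨
  (B′ ∙ exchange P u (exchange S e c)) a
    ≡⟨ ∙-cong B′ (λ k → cong (if P k then_else u k) (tr b k)) a ⟨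
  (B′ ∙ exchange P u (adj G ∙ u)) a
    ≡⟨ *ᵉ-exchange G i j ij u a ⟩
  exchange P (adj G ∙ u) u a
    ≡⟨ cong (if P a then u a else_) (tr b a) ⟩
  exchange P (exchange S e c) u a
    ≡⟨ exchange-exchange S P e c a ⟩
  exchange T e c a ∎
  where
  B′ = adj (G *ᵉ (i , j))
  P = pair i j
  T = λ k → P k xor S k
  c = λ k → C k b
  e = λ k → I k b
  u = exchange S c e

-- Induction on `vs`, the vertices still to be visited; `covers` is the invariant that all others
-- are already in `S`.
pivots-to-inverse : ∀ (C : Matrix n) (vs : List (Fin n)) S (G : Graph n) → IsTransform C S (adj G) →
  (∀ k → S k ≡ true ⊎ k ∈ vs) →
  ∃[ es ] SuccessiveEdges G es × adj (foldl _*ᵉ_ G es) ≈ C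
pivots-to-inverse C [] S G tr covers = [] , tt , λ a b → begin
  adj G a b
    ≡⟨ ∙-column (adj G) a b ⟨
  (adj G ∙ λ k → I k b) a
    ≡⟨ ∙-cong (adj G) (λ k → full (λ l → C l b) (λ l → I l b) k) a ⟨
  (adj G ∙ exchange S (λ k → C k b) (λ k → I k b)) a
    ≡⟨ tr b a ⟩
  exchange S (λ k → I k b) (λ k → C k b) a
    ≡⟨ full (λ l → I l b) (λ l → C l b) a ⟩
  C a b ∎
  where
  full : ∀ x w → exchange S x w ≗ w
  full x w k with covers k
  ... | inj₁ k∈S = cong (if_then w k else x k) k∈S
pivots-to-inverse C (i ∷ vs) S G tr covers with S i in Si≡
... | true = pivots-to-inverse C vs S G tr covers′
  where
  covers′ : ∀ k → S k ≡ true ⊎ k ∈ vs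
  covers′ k with covers k
  ... | inj₁ k∈S          = inj₁ k∈S
  ... | inj₂ (here refl)  = inj₁ Si≡
  ... | inj₂ (there k∈vs) = inj₂ k∈vs
... | false =
  let j , ij , j∉S = transform-edge C S G tr i Si≡
      es , succ , result = pivots-to-inverse C vs (λ k → pair i j k xor S k) (G *ᵉ (i , j))
        (transform-*ᵉ C S G tr ij) (covers′ j ij j∉S)
  in (i , j) ∷ es , (ij , succ) , result
  where
  -- Both ends lie outside `S`, so the symmetric difference is a disjoint union and no vertex leaves
  -- `S`.
  covers′ : ∀ j → Edge G i j → S j ≡ false → ∀ k → (pair i j k xor S k) ≡ true ⊎ k ∈ vs
  covers′ j ij j∉S k with i ≟ k | j ≟ k | covers k
  ... | yes refl | yes refl | _ = contradiction refl (edge-≢ G ij)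
  ... | yes refl | no _     | _ = inj₁ (cong not Si≡)
  ... | no _     | yes refl | _ = inj₁ (cong not j∉S)
  ... | no _     | no _     | inj₁ k∈S          = inj₁ k∈S
  ... | no i≢k   | no _     | inj₂ (here k≡i)   = contradiction (sym k≡i) i≢k
  ... | no _     | no _     | inj₂ (there k∈vs) = inj₂ k∈vs

mainTheorem6 : ∀ (n : ℕ) (G : Graph n) {{_ : Nonsingular (adj G)}} →
    ∃[ G′ ] (adj G′ ≈ adj G ⁻¹) × EdgeLocallyEquivalent G G′
mainTheorem6 n G {{ns}} =
  let es , succ , result = pivots-to-inverse (adj G ⁻¹) (allFin n) (λ _ → false) G
        -- For empty `S` the transform condition is the right-inverse equation, read column by
        -- column.
        (λ b a → Nonsingular.inverseʳ ns a b) (λ k → inj₂ (∈-allFin k))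
  -- Taking the last graph of the sequence as witness gives the inverse its symmetry and zero
  -- diagonal.
  in foldl _*ᵉ_ G es , result , es , succ , λ _ _ → refl
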